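{- If there exists an irreducible $(n,4)$-homogeneous subcube partition then $n=6$.
   Context: Subcubes of $\{0,1\}^n$ are identified with words in $\{0,1,*\}^n$; the codimension is the number of non-$*$ positions. A subcube partition of length $n$ is a partition of $\{0,1\}^n$ into subcubes; it is irreducible if no subset $G$ with $1<|G|<|F|$ has a union that is a subcube, and tight if for every coordinate $i$ some subcube $s$ has $s_i\ne*$. An $(n,k)$-homogeneous subcube partition is a tight subcube partition of length $n$ all of whose subcubes have codimension $k$. -}

module Defs where

open import Data.Nat using (ℕ; zero; suc)
open import Data.Nat.Base using (_<_)
open import Data.Bool using (Bool; true; false)
open import Data.Fin using (Fin)
open import Data.Fin.Subset using (Subset; _∈_; ∣_∣)
open import Data.Vec using (Vec; []; _∷_; lookup)
open import Data.Product using (Σ; _×_; ∃; ∃-syntax)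
open import Data.Unit using (⊤)
open import Relation.Nullary using (¬_)
open import Relation.Binary.PropositionalEquality using (_≡_)
open import Function.Bundles using (_⇔_)

data Sym : Set where
  𝟎 𝟏 ✱ : Sym

Subcube : ℕ → Set
Subcube n = Vec Sym n

Point : ℕ → Set
Point n = Vec Bool n

Compat : Sym → Bool → Set
Compat 𝟎 b = b ≡ false
Compat 𝟏 b = b ≡ true
Compat ✱ b = ⊤

_∈ᶜ_ : ∀ {n} → Point n → Subcube n → Set
x ∈ᶜ c = ∀ j → Compat (lookup c j) (lookup x j)

codim : ∀ {n} → Subcube n → ℕ
codim [] = 0
codim (𝟎 ∷ c) = suc (codim c)
codim (𝟏 ∷ c) = suc (codim c)
codim (✱ ∷ c) = codim c

IsSubcubePartition : ∀ {n m} → (Fin m → Subcube n) → Set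
IsSubcubePartition {n} {m} F =
  ∀ (x : Point n) → Σ (Fin m) λ i → x ∈ᶜ F i × (∀ i′ → x ∈ᶜ F i′ → i′ ≡ i)

Irreducible : ∀ {n m} → (Fin m → Subcube n) → Set
Irreducible {n} {m} F =
  ∀ (G : Subset m) → 1 < ∣ G ∣ → ∣ G ∣ < m →
    ¬ (Σ (Subcube n) λ c →
         ∀ (x : Point n) → (x ∈ᶜ c) ⇔ (∃[ i ] (i ∈ G × x ∈ᶜ F i)))

Tight : ∀ {n m} → (Fin m → Subcube n) → Set
Tight {n} {m} F = ∀ (j : Fin n) → ∃[ i ] (¬ (lookup (F i) j ≡ ✱))

IsHomogeneous : (n k : ℕ) → ∀ {m} → (Fin m → Subcube n) → Set
IsHomogeneous n k {m} F =
  IsSubcubePartition F × Tight F × (∀ i → codim (F i) ≡ k)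

{-# OPTIONS --safe #-}
module Submission where

-- Members of the partition that fix the same four coordinates occur equally often with even and
-- with odd sign: sum the indicators against the character of those four coordinates.  As two members
-- differing in a single coordinate would have a subcube as their union, every member has a partner
-- with the same stars that differs from it in exactly three fixed coordinates.
--
-- This makes an exhaustive search finite and small, whatever n is.  The state is a list of members,
-- seen on the coordinates fixed by at least one of them.  Take the first point they leave uncovered
-- (extended by false to the unseen coordinates), branch over the members that may cover it, and add
-- a partner.  When nothing is uncovered, the list is the whole partition, and tightness says that n
-- is the number of coordinates seen.  In every such branch this number is 6, or else some coordinate
-- is fixed by all members and each half of the cube is a union of members.

open import Defs
open import Data.Bool using (Bool; true; false; T; not; if_then_else_; _∧_; _∨_)
open import Data.Bool.ListAction using (all; any)
open import Data.Bool.Properties using (not-involutive; ∧-conicalˡ; ∧-conicalʳ; ∨-zeroʳ)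
open import Data.Empty using (⊥-elim)
open import Data.Fin using (Fin; zero; suc; _≟_)
open import Data.Fin.Properties as Fin using (any?; injective⇒≤)
open import Data.Fin.Subset using (Subset; ∣_∣) renaming (_∈_ to _∈ˢ_)
open import Data.Fin.Subset.Properties using (p⊂q⇒∣p∣<∣q∣; ∣⁅x⁆∣≡1; ∣⊤∣≡n; x∈⁅y⁆⇒x≡y; ∈⊤)
open import Data.List as List using (List; []; _∷_)
open import Data.List.Relation.Unary.All as All using (All; []; _∷_)
open import Data.List.Relation.Unary.All.Properties using (map⁺; map⁻)
open import Data.List.Relation.Unary.Any as Any using (Any; here; there)
open import Data.Maybe as Maybe using (Maybe; just; nothing; _<∣>_)
open import Data.Nat using (ℕ; zero; suc; _+_; _∸_; _≡ᵇ_; _≤_; _<_; z≤n; s≤s; z<s)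
open import Data.Nat.Properties hiding (_≟_)
open import Algebra.Properties.CommutativeMonoid.Sum +-0-commutativeMonoid using (sum)
open import Algebra.Properties.CommutativeSemigroup +-commutativeSemigroup using (interchange)
open import Data.Product using (_×_; ∃; _,_; proj₁; proj₂)
open import Data.Sum as Sum using (_⊎_; inj₁; inj₂; [_,_]′)
open import Data.Unit using (tt)
open import Data.Vec as Vec using (Vec; []; _∷_; replicate; _++_; lookup; tabulate; _[_]≔_)
open import Data.Vec.Properties using (lookup∘update; lookup∘update′; lookup-map; lookup-replicate;
  lookup∘tabulate; tabulate∘lookup; tabulate-cong; []≔-lookup; []=⇒lookup; lookup⇒[]=)
open import Data.Vec.Relation.Unary.All as VAll using ([]; _∷_)
open import Data.Vec.Relation.Unary.AllPairs using ([]; _∷_)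
open import Data.Vec.Relation.Unary.Unique.Propositional using (Unique)
open import Data.Vec.Relation.Unary.Unique.Propositional.Properties using (lookup-injective)
open import Function using (_∘_; _⇔_; mk⇔; Equivalence)
open import Relation.Binary.PropositionalEquality
open import Relation.Nullary using (¬_; Dec; yes; no; does)
open import Relation.Nullary.Decidable using (dec-true; _⊎-dec_)
open import Relation.Unary using (Decidable)

-- The search

literal : Bool → Sym
literal false = 𝟎
literal true  = 𝟏

flip : Sym → Sym
flip 𝟎 = 𝟏
flip 𝟏 = 𝟎
flip ✱ = ✱

clash : Sym → Sym → Bool
clash 𝟎 𝟏 = true
clash 𝟏 𝟎 = true
clash _ _ = false

same : Sym → Sym → Bool
same 𝟎 𝟎 = true
same 𝟏 𝟏 = true
same ✱ ✱ = true
same _ _ = false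

isFixed : Sym → Bool
isFixed ✱ = false
isFixed _ = true

equal : ∀ {k} → Subcube k → Subcube k → Bool
equal []      []      = true
equal (s ∷ c) (t ∷ d) = same s t ∧ equal c d

disjoint : ∀ {k} → Subcube k → Subcube k → Bool
disjoint []      []      = false
disjoint (s ∷ c) (t ∷ d) = clash s t ∨ disjoint c d

mergeable : ∀ {k} → Subcube k → Subcube k → Bool
mergeable []      []      = false
mergeable (s ∷ c) (t ∷ d) = if same s t then mergeable c d else clash s t ∧ equal c d

-- Holds for any two members: distinct ones are disjoint, and their union is not a subcube.
compatible : ∀ {k} → Subcube k → Subcube k → Bool
compatible c d = equal c d ∨ (disjoint c d ∧ not (mergeable c d))

-- The same stars, and a number of disagreements whose parity is given by the flag.
opposite : Bool → ∀ {k} → Subcube k → Subcube k → Bool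
opposite odd []      []      = not odd
opposite odd (s ∷ c) (t ∷ d) =
  if same s t then opposite odd c d else clash s t ∧ opposite (not odd) c d

-- A quantifier over the `d` with `opposite odd c d`, in continuation style so that no list of
-- partners is built. When the coordinates run out with the flag still odd, there is no such `d`,
-- and the test holds vacuously.
forOpposite : Bool → ∀ {k} → Subcube k → (Subcube k → Bool) → Bool
forOpposite odd []      P = odd ∨ P []
forOpposite odd (✱ ∷ c) P = forOpposite odd c λ d → P (✱ ∷ d)
forOpposite odd (s ∷ c) P =
  forOpposite odd c (λ d → P (s ∷ d)) ∧ forOpposite (not odd) c (λ d → P (flip s ∷ d))

restrict : ∀ {k} → Bool → List (Subcube (suc k)) → List (Subcube k)
restrict b []             = []
restrict b ((s ∷ c) ∷ cs) = if clash (literal b) s then restrict b cs else c ∷ restrict b cs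

gap : ∀ {k} → List (Subcube k) → Maybe (Point k)
gap {zero}  []      = just []
gap {zero}  (_ ∷ _) = nothing
gap {suc k} cs      =
  Maybe.map (false ∷_) (gap (restrict false cs)) <∣> Maybe.map (true ∷_) (gap (restrict true cs))

pillar : ∀ {k} → List (Subcube k) → Bool
pillar {zero}  cs = false
pillar {suc k} cs = all (λ c → isFixed (Vec.head c)) cs ∨ pillar (List.map Vec.tail cs)

-- Tests P on every subcube of codimension ≤ r that contains x and is disjoint from all of cs.
forCovers : ∀ {k} → Point k → List (Subcube k) → ℕ → (Subcube k → Bool) → Bool
forCovers []      []      r       P = P []
-- A member still listed here has not been separated from the candidate by any coordinate, so the
-- two are not disjoint and nothing has to be tested.
forCovers []      (_ ∷ _) r       P = true
forCovers (b ∷ x) cs      zero    P = forCovers x (List.map Vec.tail cs) zero λ t → P (✱ ∷ t)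
forCovers (b ∷ x) cs      (suc r) P =
  forCovers x (List.map Vec.tail cs) (suc r) (λ t → P (✱ ∷ t)) ∧
  forCovers x (restrict b cs) r (λ t → P (literal b ∷ t))

-- The first argument bounds the depth.  New coordinates are put in front of the known ones; the
-- subcube that brings them in has 𝟎 there because the point it covers is false off the known ones.
search : ℕ → ∀ {k} → List (Subcube k) → Bool
branch : ℕ → ∀ {k} → List (Subcube k) → Maybe (Point k) → Bool
extend : ℕ → ∀ {k} → List (Subcube k) → Subcube k → Bool

-- Exhausted depth counts as failure, so the value `true` certifies that every branch was closed.
search zero    cs = false
search (suc f) cs = branch f cs (gap cs)

branch f {k} cs nothing  = (k ≡ᵇ 6) ∨ pillar cs
-- A member has codimension 4, so `r` is the number of unseen coordinates that the covering member
-- fixes.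
branch f     cs (just x) = forCovers x cs 4 λ t → let r = 4 ∸ codim t in
  extend f (List.map (replicate r ✱ ++_) cs) (replicate r 𝟎 ++ t)

-- A candidate that is incompatible with a listed member is no member, so its branch closes at once.
extend f cs t = not (all (compatible t) cs) ∨
  (if any (opposite true t) cs
   then search f (t ∷ cs)
   else forOpposite true t λ u → not (all (compatible u) (t ∷ cs)) ∨ search f (u ∷ t ∷ cs))

-- Correctness of the building blocks

true≢false : true ≢ false
true≢false ()

_◂_ : ∀ {k s b} {x : Point k} {c : Subcube k} → Compat s b → x ∈ᶜ c → (b ∷ x) ∈ᶜ (s ∷ c)
(p ◂ q) zero    = p
(p ◂ q) (suc j) = q j

compat⇒¬clash : ∀ b s → Compat s b → clash (literal b) s ≡ false
compat⇒¬clash false 𝟎 _ = refl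
compat⇒¬clash false ✱ _ = refl
compat⇒¬clash true  𝟏 _ = refl
compat⇒¬clash true  ✱ _ = refl

¬clash⇒compat : ∀ b s → clash (literal b) s ≡ false → Compat s b
¬clash⇒compat false 𝟎 _ = refl
¬clash⇒compat false ✱ _ = tt
¬clash⇒compat true  𝟏 _ = refl
¬clash⇒compat true  ✱ _ = tt

fixed-𝟎 : ∀ {s} → s ≢ ✱ → Compat s false → s ≡ 𝟎
fixed-𝟎 {𝟎} _   _ = refl
fixed-𝟎 {✱} s≢✱ _ = ⊥-elim (s≢✱ refl)

compat-both : ∀ s b → Compat s b → Compat s (not b) → s ≡ ✱
compat-both 𝟎 false _ ()
compat-both 𝟏 true  _ ()
compat-both ✱ _     _ _ = refl

same⇒≡ : ∀ s t → same s t ≡ true → s ≡ t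
same⇒≡ 𝟎 𝟎 _ = refl
same⇒≡ 𝟏 𝟏 _ = refl
same⇒≡ ✱ ✱ _ = refl

same-refl : ∀ s → same s s ≡ true
same-refl 𝟎 = refl
same-refl 𝟏 = refl
same-refl ✱ = refl

equal-refl : ∀ {k} (c : Subcube k) → equal c c ≡ true
equal-refl []      = refl
equal-refl (s ∷ c) rewrite same-refl s = equal-refl c

equal⇒≡ : ∀ {k} (c d : Subcube k) → equal c d ≡ true → c ≡ d
equal⇒≡ []      []      _ = refl
equal⇒≡ (s ∷ c) (t ∷ d) e =
  cong₂ _∷_ (same⇒≡ s t (∧-conicalˡ _ _ e)) (equal⇒≡ c d (∧-conicalʳ (same s t) _ e))

disjoint-or-meet : ∀ {k} (c d : Subcube k) →
  disjoint c d ≡ true ⊎ ∃ λ x → x ∈ᶜ c × x ∈ᶜ d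
disjoint-or-meet []      []      = inj₂ ([] , (λ ()) , λ ())
disjoint-or-meet (s ∷ c) (t ∷ d) with clash s t in e | disjoint-or-meet c d
... | true  | _      = inj₁ refl
... | false | inj₁ p = inj₁ p
... | false | inj₂ (x , x∈c , x∈d) =
  let b , p , q = common s t e in inj₂ (b ∷ x , p ◂ x∈c , q ◂ x∈d)
  where
  common : ∀ s t → clash s t ≡ false → ∃ λ b → Compat s b × Compat t b
  common 𝟎 𝟎 _ = false , refl , refl
  common 𝟎 ✱ _ = false , refl , tt
  common 𝟏 𝟏 _ = true , refl , refl
  common 𝟏 ✱ _ = true , refl , tt
  common ✱ 𝟎 _ = false , tt , refl
  common ✱ 𝟏 _ = true , tt , refl
  common ✱ ✱ _ = true , tt , tt

width : Sym → ℕ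
width ✱ = 0
width _ = 1

codim-∷ : ∀ {k} s (c : Subcube k) → codim (s ∷ c) ≡ width s + codim c
codim-∷ 𝟎 c = refl
codim-∷ 𝟏 c = refl
codim-∷ ✱ c = refl

-- Put ✱ at the one clashing coordinate. The drop in codimension is recorded because it later bounds
-- the size of the union.
mergeable⇒union : ∀ {k} (c d : Subcube k) → mergeable c d ≡ true →
  ∃ λ e → suc (codim e) ≡ codim c × (∀ x → x ∈ᶜ e ⇔ (x ∈ᶜ c ⊎ x ∈ᶜ d))
mergeable⇒union []      []      ()
mergeable⇒union (s ∷ c) (t ∷ d) m with same s t in st
... | true  rewrite same⇒≡ s t st with mergeable⇒union c d m
...   | e , codim-e , union = t ∷ e , codim-te , λ where
        (b ∷ x) → mk⇔
          (λ p → Sum.map (p zero ◂_) (p zero ◂_) (Equivalence.to (union x) (p ∘ suc)))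
          [ (λ p → p zero ◂ Equivalence.from (union x) (inj₁ (p ∘ suc)))
          , (λ p → p zero ◂ Equivalence.from (union x) (inj₂ (p ∘ suc))) ]′
  where
  codim-te : suc (codim (t ∷ e)) ≡ codim (t ∷ c)
  codim-te rewrite codim-∷ t e | codim-∷ t c | sym codim-e = sym (+-suc (width t) (codim e))
mergeable⇒union (s ∷ c) (t ∷ d) m | false
  rewrite equal⇒≡ c d (∧-conicalʳ (clash s t) _ m) =
  ✱ ∷ d , codim-fixed s t (∧-conicalˡ _ _ m) , λ where
    (b ∷ x) → mk⇔
      (λ p → Sum.map (_◂ (p ∘ suc)) (_◂ (p ∘ suc)) (split s t b (∧-conicalˡ _ _ m)))
      [ (λ p → tt ◂ (p ∘ suc)) , (λ p → tt ◂ (p ∘ suc)) ]′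
  where
  codim-fixed : ∀ s t → clash s t ≡ true → suc (codim d) ≡ codim (s ∷ d)
  codim-fixed 𝟎 𝟏 _ = refl
  codim-fixed 𝟏 𝟎 _ = refl
  split : ∀ s t b → clash s t ≡ true → Compat s b ⊎ Compat t b
  split 𝟎 𝟏 false _ = inj₁ refl
  split 𝟎 𝟏 true  _ = inj₂ refl
  split 𝟏 𝟎 false _ = inj₂ refl
  split 𝟏 𝟎 true  _ = inj₁ refl

forOpposite-sound : ∀ odd {k} (c d : Subcube k) P →
  forOpposite odd c P ≡ true → opposite odd c d ≡ true → P d ≡ true
forOpposite-sound false []      []      P h o = h
forOpposite-sound true  []      []      P h ()
forOpposite-sound odd (✱ ∷ c) (✱ ∷ d) P h o = forOpposite-sound odd c d _ h o
forOpposite-sound odd (𝟎 ∷ c) (𝟎 ∷ d) P h o = forOpposite-sound odd c d _ (∧-conicalˡ _ _ h) o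
forOpposite-sound odd (𝟎 ∷ c) (𝟏 ∷ d) P h o =
  forOpposite-sound (not odd) c d _ (∧-conicalʳ (forOpposite odd c _) _ h) o
forOpposite-sound odd (𝟏 ∷ c) (𝟎 ∷ d) P h o =
  forOpposite-sound (not odd) c d _ (∧-conicalʳ (forOpposite odd c _) _ h) o
forOpposite-sound odd (𝟏 ∷ c) (𝟏 ∷ d) P h o = forOpposite-sound odd c d _ (∧-conicalˡ _ _ h) o

restrict-avoids : ∀ {k} b (cs : List (Subcube (suc k))) {x} →
  All (λ c → ¬ (x ∈ᶜ c)) (restrict b cs) → All (λ c → ¬ ((b ∷ x) ∈ᶜ c)) cs
restrict-avoids b []             h = []
restrict-avoids b ((s ∷ c) ∷ cs) h with clash (literal b) s in e
restrict-avoids b ((s ∷ c) ∷ cs) h       | true  =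
  (λ p → true≢false (trans (sym e) (compat⇒¬clash b s (p zero)))) ∷ restrict-avoids b cs h
restrict-avoids b ((s ∷ c) ∷ cs) (q ∷ h) | false = (λ p → q (p ∘ suc)) ∷ restrict-avoids b cs h

restrict-covers : ∀ {k} b (cs : List (Subcube (suc k))) {x} →
  Any (x ∈ᶜ_) (restrict b cs) → Any ((b ∷ x) ∈ᶜ_) cs
restrict-covers b ((s ∷ c) ∷ cs) h with clash (literal b) s in e
restrict-covers b ((s ∷ c) ∷ cs) h         | true  = there (restrict-covers b cs h)
restrict-covers b ((s ∷ c) ∷ cs) (here p)  | false = here (¬clash⇒compat b s e ◂ p)
restrict-covers b ((s ∷ c) ∷ cs) (there h) | false = there (restrict-covers b cs h)

gap-uncovered : ∀ {k} (cs : List (Subcube k)) {x} → gap cs ≡ just x → All (λ c → ¬ (x ∈ᶜ c)) cs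
gap-uncovered {zero}  []  _ = []
gap-uncovered {suc k} cs  e with gap (restrict false cs) in e₀ | gap (restrict true cs) in e₁
gap-uncovered {suc k} cs refl | just x  | _      = restrict-avoids false cs (gap-uncovered _ e₀)
gap-uncovered {suc k} cs refl | nothing | just x = restrict-avoids true cs (gap-uncovered _ e₁)

no-gap : ∀ {k} (cs : List (Subcube k)) → gap cs ≡ nothing → ∀ x → Any (x ∈ᶜ_) cs
no-gap {zero}  (c ∷ _) _ [] = here λ ()
no-gap {suc k} cs      e x with gap (restrict false cs) in e₀ | gap (restrict true cs) in e₁
no-gap {suc k} cs      e (false ∷ x) | nothing | nothing = restrict-covers false cs (no-gap _ e₀ x)
no-gap {suc k} cs      e (true  ∷ x) | nothing | nothing = restrict-covers true cs (no-gap _ e₁ x)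

all⁻ : ∀ {A : Set} (p : A → Bool) xs → all p xs ≡ true → All (λ x → p x ≡ true) xs
all⁻ p []       _ = []
all⁻ p (x ∷ xs) h = ∧-conicalˡ _ _ h ∷ all⁻ p xs (∧-conicalʳ (p x) _ h)

all⁺ : ∀ {A : Set} (p : A → Bool) {xs} → All (λ x → p x ≡ true) xs → all p xs ≡ true
all⁺ p []       = refl
all⁺ p (q ∷ qs) rewrite q = all⁺ p qs

pillar-sound : ∀ {k} (cs : List (Subcube k)) → pillar cs ≡ true →
  ∃ λ j → All (λ c → isFixed (lookup c j) ≡ true) cs
pillar-sound {suc k} cs h with all (λ c → isFixed (Vec.head c)) cs in e
... | true  = zero , All.map (λ { {_ ∷ _} p → p }) (all⁻ _ cs e)
... | false with pillar-sound (List.map Vec.tail cs) h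
...   | j , ps = suc j , All.map (λ { {_ ∷ _} p → p }) (map⁻ ps)

restrict-disjoint : ∀ {k} b (cs : List (Subcube (suc k))) {t : Subcube k} →
  All (λ c → disjoint (literal b ∷ t) c ≡ true) cs → All (λ c → disjoint t c ≡ true) (restrict b cs)
restrict-disjoint b []             []       = []
restrict-disjoint b ((s ∷ c) ∷ cs) (d ∷ ds) with clash (literal b) s
... | true  = restrict-disjoint b cs ds
... | false = d ∷ restrict-disjoint b cs ds

forCovers-sound : ∀ {k} (x : Point k) cs r P t → forCovers x cs r P ≡ true →
  x ∈ᶜ t → codim t ≤ r → All (λ c → disjoint t c ≡ true) cs → P t ≡ true
forCovers-sound []      []       r P []      h x∈t t≤r ds = h
forCovers-sound []      ([] ∷ _) r P []      h x∈t t≤r (() ∷ _)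
forCovers-sound (b ∷ x) cs zero    P (𝟎 ∷ t) h x∈t () ds
forCovers-sound (b ∷ x) cs zero    P (𝟏 ∷ t) h x∈t () ds
forCovers-sound (b ∷ x) cs zero    P (✱ ∷ t) h x∈t t≤r ds =
  forCovers-sound x _ zero _ t h (x∈t ∘ suc) t≤r (map⁺ (All.map (λ { {_ ∷ _} p → p }) ds))
forCovers-sound (b ∷ x) cs (suc r) P (✱ ∷ t) h x∈t t≤r ds =
  forCovers-sound x _ (suc r) _ t (∧-conicalˡ _ _ h) (x∈t ∘ suc) t≤r
    (map⁺ (All.map (λ { {_ ∷ _} p → p }) ds))
forCovers-sound (false ∷ x) cs (suc r) P (𝟎 ∷ t) h x∈t (s≤s t≤r) ds =
  forCovers-sound x _ r _ t (∧-conicalʳ (forCovers x (List.map Vec.tail cs) (suc r) _) _ h)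
    (x∈t ∘ suc) t≤r (restrict-disjoint false cs ds)
forCovers-sound (true  ∷ x) cs (suc r) P (𝟏 ∷ t) h x∈t (s≤s t≤r) ds =
  forCovers-sound x _ r _ t (∧-conicalʳ (forCovers x (List.map Vec.tail cs) (suc r) _) _ h)
    (x∈t ∘ suc) t≤r (restrict-disjoint true cs ds)
forCovers-sound (false ∷ x) cs (suc r) P (𝟏 ∷ t) h x∈t t≤r ds with () ← x∈t zero
forCovers-sound (true  ∷ x) cs (suc r) P (𝟎 ∷ t) h x∈t t≤r ds with () ← x∈t zero

-- Sums over points of either sign

-- The sum of g over the points that are false on the stars of c and disagree with c
-- in an odd (resp. even) number of the remaining coordinates.
parity : Bool → ∀ {k} → Subcube k → (Point k → ℕ) → ℕ
parity odd []      g = if odd then 0 else g []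
parity odd (✱ ∷ c) g = parity odd c (g ∘ (false ∷_))
parity odd (𝟎 ∷ c) g = parity odd c (g ∘ (false ∷_)) + parity (not odd) c (g ∘ (true ∷_))
parity odd (𝟏 ∷ c) g = parity odd c (g ∘ (true ∷_)) + parity (not odd) c (g ∘ (false ∷_))

indicator : ∀ {k} → Subcube k → Point k → ℕ
indicator []      []      = 1
indicator (s ∷ c) (b ∷ x) = if clash (literal b) s then 0 else indicator c x

indicator-∈ : ∀ {k} (c : Subcube k) x → x ∈ᶜ c → indicator c x ≡ 1
indicator-∈ []      []      _ = refl
indicator-∈ (s ∷ c) (b ∷ x) p rewrite compat⇒¬clash b s (p zero) = indicator-∈ c x (p ∘ suc)

indicator>0⇒∈ : ∀ {k} (c : Subcube k) x → 0 < indicator c x → x ∈ᶜ c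
indicator>0⇒∈ []      []      _ = λ ()
indicator>0⇒∈ (s ∷ c) (b ∷ x) h with clash (literal b) s in e
... | false = ¬clash⇒compat b s e ◂ indicator>0⇒∈ c x h

-- An indicator is 1 on its subcube and 0 elsewhere, so membership determines its value.
indicator-cong : ∀ {k l} (c : Subcube k) (d : Subcube l) x y →
  x ∈ᶜ c ⇔ y ∈ᶜ d → indicator c x ≡ indicator d y
indicator-cong c d x y eqv with indicator c x in e₁ | indicator d y in e₂
... | zero  | zero  = refl
... | zero  | suc _ = trans (sym e₁) (trans
  (indicator-∈ c x (Equivalence.from eqv (indicator>0⇒∈ d y (subst (0 <_) (sym e₂) z<s))))
  (trans (sym (indicator-∈ d y (indicator>0⇒∈ d y (subst (0 <_) (sym e₂) z<s)))) e₂))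
... | suc _ | _ = trans (sym e₁) (trans
  (indicator-∈ c x (indicator>0⇒∈ c x (subst (0 <_) (sym e₁) z<s)))
  (trans (sym (indicator-∈ d y (Equivalence.to eqv (indicator>0⇒∈ c x (subst (0 <_) (sym e₁) z<s))))) e₂))

parity-cong : ∀ odd {k} (c : Subcube k) {g h} → g ≗ h → parity odd c g ≡ parity odd c h
parity-cong false []      e = e []
parity-cong true  []      e = refl
parity-cong odd   (✱ ∷ c) e = parity-cong odd c (e ∘ (false ∷_))
parity-cong odd   (𝟎 ∷ c) e =
  cong₂ _+_ (parity-cong odd c (e ∘ (false ∷_))) (parity-cong (not odd) c (e ∘ (true ∷_)))
parity-cong odd   (𝟏 ∷ c) e =
  cong₂ _+_ (parity-cong odd c (e ∘ (true ∷_))) (parity-cong (not odd) c (e ∘ (false ∷_)))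

parity-0 : ∀ odd {k} (c : Subcube k) → parity odd c (λ _ → 0) ≡ 0
parity-0 false []      = refl
parity-0 true  []      = refl
parity-0 odd   (✱ ∷ c) = parity-0 odd c
parity-0 odd   (𝟎 ∷ c) = cong₂ _+_ (parity-0 odd c) (parity-0 (not odd) c)
parity-0 odd   (𝟏 ∷ c) = cong₂ _+_ (parity-0 odd c) (parity-0 (not odd) c)

parity-+ : ∀ odd {k} (c : Subcube k) g h →
  parity odd c (λ x → g x + h x) ≡ parity odd c g + parity odd c h
parity-+ false []      g h = refl
parity-+ true  []      g h = refl
parity-+ odd   (✱ ∷ c) g h = parity-+ odd c _ _
parity-+ odd   (𝟎 ∷ c) g h = trans (cong₂ _+_ (parity-+ odd c _ _) (parity-+ (not odd) c _ _))
  (interchange (parity odd c (g ∘ (false ∷_))) _ _ _)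
parity-+ odd   (𝟏 ∷ c) g h = trans (cong₂ _+_ (parity-+ odd c _ _) (parity-+ (not odd) c _ _))
  (interchange (parity odd c (g ∘ (true ∷_))) _ _ _)

parity-sum : ∀ odd {k} (c : Subcube k) {m} (g : Fin m → Point k → ℕ) →
  parity odd c (λ x → sum (λ i → g i x)) ≡ sum (λ i → parity odd c (g i))
parity-sum odd c {zero}  g = parity-0 odd c
parity-sum odd c {suc m} g =
  trans (parity-+ odd c (g zero) _) (cong (parity odd c (g zero) +_) (parity-sum odd c (g ∘ suc)))

-- Flipping a fixed coordinate on which the summand does not depend: the same two partial sums
-- appear in the other order. The double negation is what unfolding `parity` produces.
parity-swap : ∀ odd {k} (c : Subcube k) g h →
  parity odd c g + parity (not odd) c h ≡ parity (not odd) c h + parity (not (not odd)) c g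
parity-swap odd c g h rewrite not-involutive odd = +-comm (parity odd c g) _

parity-balanced : ∀ odd {k} (c : Subcube k) → 0 < codim c →
  parity odd c (λ _ → 1) ≡ parity (not odd) c (λ _ → 1)
parity-balanced odd (✱ ∷ c) h = parity-balanced odd c h
parity-balanced odd (𝟎 ∷ c) h = parity-swap odd c _ _
parity-balanced odd (𝟏 ∷ c) h = parity-swap odd c _ _

-- Flipping a coordinate that c fixes and d leaves free exchanges the two parities.
parity-wider : ∀ odd {k} (c d : Subcube k) → codim d < codim c →
  parity odd c (indicator d) ≡ parity (not odd) c (indicator d)
parity-wider odd (✱ ∷ c) (✱ ∷ d) h = parity-wider odd c d h
parity-wider odd (✱ ∷ c) (𝟎 ∷ d) h = parity-wider odd c d (<-trans (n<1+n _) h)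
parity-wider odd (✱ ∷ c) (𝟏 ∷ d) h rewrite parity-0 odd c | parity-0 (not odd) c = refl
parity-wider odd (𝟎 ∷ c) (✱ ∷ d) h = parity-swap odd c _ _
parity-wider odd (𝟏 ∷ c) (✱ ∷ d) h = parity-swap odd c _ _
parity-wider odd (𝟎 ∷ c) (𝟎 ∷ d) (s≤s h) rewrite parity-0 (not odd) c | parity-0 (not (not odd)) c
  = cong (_+ 0) (parity-wider odd c d h)
parity-wider odd (𝟏 ∷ c) (𝟏 ∷ d) (s≤s h) rewrite parity-0 (not odd) c | parity-0 (not (not odd)) c
  = cong (_+ 0) (parity-wider odd c d h)
parity-wider odd (𝟎 ∷ c) (𝟏 ∷ d) (s≤s h) rewrite parity-0 odd c | parity-0 (not odd) c
  = parity-wider (not odd) c d h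
parity-wider odd (𝟏 ∷ c) (𝟎 ∷ d) (s≤s h) rewrite parity-0 odd c | parity-0 (not odd) c
  = parity-wider (not odd) c d h

-- If `d` leaves free a coordinate fixed by `c`, the two sums agree. Otherwise the codimensions
-- force equal stars, and `d` selects a single point, which lies on the side given by its number of
-- disagreements with `c`.
parity-not-opposite : ∀ odd {k} (c d : Subcube k) → codim d ≤ codim c → opposite odd c d ≡ false →
  parity odd c (indicator d) ≤ parity (not odd) c (indicator d)
parity-not-opposite true []      []      h o = z≤n
parity-not-opposite false []     []      h ()
parity-not-opposite odd (✱ ∷ c) (✱ ∷ d) h o = parity-not-opposite odd c d h o
parity-not-opposite odd (✱ ∷ c) (𝟎 ∷ d) h o = ≤-reflexive (parity-wider odd c d h)
parity-not-opposite odd (✱ ∷ c) (𝟏 ∷ d) h o rewrite parity-0 odd c = z≤n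
parity-not-opposite odd (𝟎 ∷ c) (✱ ∷ d) h o = ≤-reflexive (parity-swap odd c _ _)
parity-not-opposite odd (𝟏 ∷ c) (✱ ∷ d) h o = ≤-reflexive (parity-swap odd c _ _)
parity-not-opposite odd (𝟎 ∷ c) (𝟎 ∷ d) (s≤s h) o
  rewrite parity-0 (not odd) c | parity-0 (not (not odd)) c
  = +-monoˡ-≤ 0 (parity-not-opposite odd c d h o)
parity-not-opposite odd (𝟏 ∷ c) (𝟏 ∷ d) (s≤s h) o
  rewrite parity-0 (not odd) c | parity-0 (not (not odd)) c
  = +-monoˡ-≤ 0 (parity-not-opposite odd c d h o)
parity-not-opposite odd (𝟎 ∷ c) (𝟏 ∷ d) (s≤s h) o rewrite parity-0 odd c | parity-0 (not odd) c
  = parity-not-opposite (not odd) c d h o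
parity-not-opposite odd (𝟏 ∷ c) (𝟎 ∷ d) (s≤s h) o rewrite parity-0 odd c | parity-0 (not odd) c
  = parity-not-opposite (not odd) c d h o

parity>0⇒∃ : ∀ odd {k} (c : Subcube k) {g} → 0 < parity odd c g → ∃ λ x → 0 < g x
parity>0⇒∃ false []      h = [] , h
parity>0⇒∃ odd   (✱ ∷ c) h = let x , p = parity>0⇒∃ odd c h in false ∷ x , p
parity>0⇒∃ odd   (𝟎 ∷ c) {g} h with parity odd c (g ∘ (false ∷_)) in e
... | zero  = let x , p = parity>0⇒∃ (not odd) c h in true ∷ x , p
... | suc _ = let x , p = parity>0⇒∃ odd c (subst (0 <_) (sym e) z<s) in false ∷ x , p
parity>0⇒∃ odd   (𝟏 ∷ c) {g} h with parity odd c (g ∘ (true ∷_)) in e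
... | zero  = let x , p = parity>0⇒∃ (not odd) c h in false ∷ x , p
... | suc _ = let x , p = parity>0⇒∃ odd c (subst (0 <_) (sym e) z<s) in true ∷ x , p

parity-self : ∀ {k} (c : Subcube k) →
  parity true c (indicator c) ≡ 0 × parity false c (indicator c) ≡ 1
parity-self []      = refl , refl
parity-self (✱ ∷ c) = parity-self c
parity-self (𝟎 ∷ c) rewrite parity-0 false c | parity-0 true c =
  let p , q = parity-self c in cong (_+ 0) p , cong (_+ 0) q
parity-self (𝟏 ∷ c) rewrite parity-0 false c | parity-0 true c =
  let p , q = parity-self c in cong (_+ 0) p , cong (_+ 0) q

opposite⇒codim : ∀ odd {k} (c d : Subcube k) → opposite odd c d ≡ true → codim c ≡ codim d
opposite⇒codim odd []      []      o = refl
opposite⇒codim odd (✱ ∷ c) (✱ ∷ d) o = opposite⇒codim odd c d o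
opposite⇒codim odd (𝟎 ∷ c) (𝟎 ∷ d) o = cong suc (opposite⇒codim odd c d o)
opposite⇒codim odd (𝟏 ∷ c) (𝟏 ∷ d) o = cong suc (opposite⇒codim odd c d o)
opposite⇒codim odd (𝟎 ∷ c) (𝟏 ∷ d) o = cong suc (opposite⇒codim (not odd) c d o)
opposite⇒codim odd (𝟏 ∷ c) (𝟎 ∷ d) o = cong suc (opposite⇒codim (not odd) c d o)

sum-0 : ∀ {m} {f : Fin m → ℕ} → (∀ i → f i ≡ 0) → sum f ≡ 0
sum-0 {zero}  h = refl
sum-0 {suc m} h = cong₂ _+_ (h zero) (sum-0 (h ∘ suc))

sum-1 : ∀ {m} {f : Fin m → ℕ} i → f i ≡ 1 → (∀ j → j ≢ i → f j ≡ 0) → sum f ≡ 1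
sum-1 zero    p h = cong₂ _+_ p (sum-0 λ j → h (suc j) λ ())
sum-1 (suc i) p h = cong₂ _+_ (h zero λ ()) (sum-1 i p λ j j≢i → h (suc j) (j≢i ∘ Fin.suc-injective))

sum-≤ : ∀ {m} {f g : Fin m → ℕ} → (∀ i → f i ≤ g i) → sum f ≤ sum g
sum-≤ {zero}  h = z≤n
sum-≤ {suc m} h = +-mono-≤ (h zero) (sum-≤ (h ∘ suc))

sum-< : ∀ {m} {f g : Fin m → ℕ} i → f i < g i → (∀ i → f i ≤ g i) → sum f < sum g
sum-< zero    p h = +-mono-<-≤ p (sum-≤ (h ∘ suc))
sum-< (suc i) p h = +-mono-≤-< (h zero) (sum-< i p (h ∘ suc))

-- The constant 1 gives the same odd and even sums, so an even excess of one summand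
-- is compensated by an odd excess of another.
odd-excess : ∀ {m k} (g : Fin m → Point k → ℕ) → (∀ x → sum (λ i → g i x) ≡ 1) →
  ∀ c → 0 < codim c → ∀ i → parity true c (g i) < parity false c (g i) →
  ∃ λ j → parity false c (g j) < parity true c (g j)
odd-excess g total c c>0 i h with any? (λ j → parity false c (g j) <? parity true c (g j))
... | yes p = p
... | no ¬p = ⊥-elim (<-irrefl balance (sum-< i h λ j → ≮⇒≥ (λ q → ¬p (j , q))))
  where
  ofOne : ∀ odd → sum (λ i → parity odd c (g i)) ≡ parity odd c (λ _ → 1)
  ofOne odd = trans (sym (parity-sum odd c g)) (parity-cong odd c total)
  balance : sum (λ i → parity true c (g i)) ≡ sum (λ i → parity false c (g i))
  balance = trans (ofOne true) (trans (parity-balanced true c c>0) (sym (ofOne false)))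

-- Seeing a subcube through a list of coordinates

lookup-ext : ∀ {A : Set} {n} {xs ys : Vec A n} → lookup xs ≗ lookup ys → xs ≡ ys
lookup-ext {xs = xs} {ys} e =
  trans (sym (tabulate∘lookup xs)) (trans (tabulate-cong e) (tabulate∘lookup ys))

codim≡0⇒✱ : ∀ {n} (c : Subcube n) → codim c ≡ 0 → ∀ v → lookup c v ≡ ✱
codim≡0⇒✱ (✱ ∷ c) h zero    = refl
codim≡0⇒✱ (✱ ∷ c) h (suc v) = codim≡0⇒✱ c h v

codim-✱ : ∀ n → codim (replicate n ✱) ≡ 0
codim-✱ zero    = refl
codim-✱ (suc n) = codim-✱ n

codim-𝟎 : ∀ n {k} (c : Subcube k) → codim (replicate n 𝟎 ++ c) ≡ n + codim c
codim-𝟎 zero    c = refl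
codim-𝟎 (suc n) c = cong suc (codim-𝟎 n c)

codim>0⇒fixed : ∀ {n} (c : Subcube n) → 0 < codim c → ∃ λ v → lookup c v ≢ ✱
codim>0⇒fixed (𝟎 ∷ c) h = zero , λ ()
codim>0⇒fixed (𝟏 ∷ c) h = zero , λ ()
codim>0⇒fixed (✱ ∷ c) h = let v , p = codim>0⇒fixed c h in suc v , p

codim-erase : ∀ {n} (c : Subcube n) v → codim c ≡ width (lookup c v) + codim (c [ v ]≔ ✱)
codim-erase (s ∷ c) zero    = codim-∷ s c
codim-erase (s ∷ c) (suc v)
  rewrite codim-∷ s c | codim-∷ s (c [ v ]≔ ✱) | codim-erase c v
  = trans (sym (+-assoc (width s) _ _))
    (trans (cong (_+ codim (c [ v ]≔ ✱)) (+-comm (width s) _)) (+-assoc (width (lookup c v)) _ _))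

inhabited : ∀ {n} (c : Subcube n) → ∃ λ x → x ∈ᶜ c
inhabited []      = [] , λ ()
inhabited (𝟎 ∷ c) = let x , p = inhabited c in false ∷ x , refl ◂ p
inhabited (𝟏 ∷ c) = let x , p = inhabited c in true ∷ x , refl ◂ p
inhabited (✱ ∷ c) = let x , p = inhabited c in true ∷ x , tt ◂ p

avoidable : ∀ {n} (c : Subcube n) → 0 < codim c → ∃ λ x → ¬ (x ∈ᶜ c)
avoidable (𝟎 ∷ c) h = true ∷ replicate _ true , λ p → true≢false (p zero)
avoidable (𝟏 ∷ c) h = false ∷ replicate _ true , λ p → true≢false (sym (p zero))
avoidable (✱ ∷ c) h = let x , p = avoidable c h in true ∷ x , λ q → p (q ∘ suc)

module _ {n : ℕ} where

  _∉_ : ∀ {k} → Fin n → Vec (Fin n) k → Set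
  v ∉ ρ = VAll.All (v ≢_) ρ

  -- Throughout, `ρ` lists the coordinates seen so far. Reading through it serves points and
  -- subcubes alike.
  pull : ∀ {A : Set} {k} → Vec (Fin n) k → Vec A n → Vec A k
  pull ρ xs = Vec.map (lookup xs) ρ

  plug : ∀ {A : Set} {k} → Vec (Fin n) k → Vec A k → Vec A n → Vec A n
  plug []      []       ys = ys
  plug (v ∷ ρ) (x ∷ xs) ys = plug ρ xs (ys [ v ]≔ x)

  -- What `ρ` does not see of `c`: for `ρ` without repetitions, its codimension counts the fixed
  -- coordinates still to be discovered.
  erase : ∀ {k} → Vec (Fin n) k → Subcube n → Subcube n
  erase ρ c = plug ρ (replicate _ ✱) c

  lift : ∀ {k} → Vec (Fin n) k → Subcube k → Subcube n
  lift ρ c = plug ρ c (replicate n ✱)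

  embed : ∀ {k} → Vec (Fin n) k → Point k → Point n
  embed ρ x = plug ρ x (replicate n false)

  locate : ∀ {k} (ρ : Vec (Fin n) k) v → (∃ λ j → lookup ρ j ≡ v) ⊎ v ∉ ρ
  locate []      v = inj₂ []
  locate (u ∷ ρ) v with v ≟ u | locate ρ v
  ... | yes refl | _               = inj₁ (zero , refl)
  ... | no _     | inj₁ (j , refl) = inj₁ (suc j , refl)
  ... | no v≢u   | inj₂ v∉ρ        = inj₂ (v≢u ∷ v∉ρ)

  plug-∉ : ∀ {A : Set} {k} {ρ : Vec (Fin n) k} {v} → v ∉ ρ → ∀ (xs : Vec A k) ys →
    lookup (plug ρ xs ys) v ≡ lookup ys v
  plug-∉ []          []       ys = refl
  plug-∉ (v≢u ∷ v∉ρ) (x ∷ xs) ys = trans (plug-∉ v∉ρ xs _) (lookup∘update′ v≢u ys x)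

  pull-update : ∀ {A : Set} {k} {ρ : Vec (Fin n) k} {v} → v ∉ ρ → ∀ (ys : Vec A n) y →
    pull ρ (ys [ v ]≔ y) ≡ pull ρ ys
  pull-update []          ys y = refl
  pull-update (v≢u ∷ v∉ρ) ys y = cong₂ _∷_ (lookup∘update′ (v≢u ∘ sym) ys y) (pull-update v∉ρ ys y)

  pull-plug : ∀ {A : Set} {k} {ρ : Vec (Fin n) k} → Unique ρ → ∀ (xs : Vec A k) ys →
    pull ρ (plug ρ xs ys) ≡ xs
  pull-plug {ρ = []}    _         []       ys = refl
  pull-plug {ρ = v ∷ ρ} (v∉ρ ∷ u) (x ∷ xs) ys =
    cong₂ _∷_ (trans (plug-∉ v∉ρ xs _) (lookup∘update v ys x)) (pull-plug u xs _)

  plug-∈ : ∀ {A : Set} {k} {ρ : Vec (Fin n) k} → Unique ρ → ∀ (xs : Vec A k) ys j →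
    lookup (plug ρ xs ys) (lookup ρ j) ≡ lookup xs j
  plug-∈ {ρ = ρ} u xs ys j =
    trans (sym (lookup-map j _ ρ)) (cong (λ zs → lookup zs j) (pull-plug u xs ys))

  -- Erase the coordinates one by one; as they are distinct, erasing one does not alter how the
  -- others are read.
  codim-split : ∀ {k} {ρ : Vec (Fin n) k} → Unique ρ → ∀ c →
    codim c ≡ codim (pull ρ c) + codim (erase ρ c)
  codim-split {ρ = []}    []        c = refl
  codim-split {ρ = v ∷ ρ} (v∉ρ ∷ u) c = begin
    codim c
      ≡⟨ codim-erase c v ⟩
    width (lookup c v) + codim (c [ v ]≔ ✱)
      ≡⟨ cong (width (lookup c v) +_) (codim-split u (c [ v ]≔ ✱)) ⟩
    width (lookup c v) + (codim (pull ρ (c [ v ]≔ ✱)) + rest)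
      ≡⟨ cong (λ d → width (lookup c v) + (codim d + rest)) (pull-update v∉ρ c ✱) ⟩
    width (lookup c v) + (codim (pull ρ c) + rest)
      ≡⟨ +-assoc (width (lookup c v)) _ _ ⟨
    (width (lookup c v) + codim (pull ρ c)) + rest
      ≡⟨ cong (_+ rest) (codim-∷ (lookup c v) _) ⟨
    codim (pull (v ∷ ρ) c) + rest ∎
    where
    open ≡-Reasoning
    rest = codim (erase ρ (c [ v ]≔ ✱))

  pull-∈ : ∀ {k} (ρ : Vec (Fin n) k) c x → x ∈ᶜ c → pull ρ x ∈ᶜ pull ρ c
  pull-∈ ρ c x p j =
    subst₂ Compat (sym (lookup-map j (lookup c) ρ)) (sym (lookup-map j (lookup x) ρ)) (p (lookup ρ j))

  lookup-embed : ∀ {k} {ρ : Vec (Fin n) k} x {v} → v ∉ ρ → lookup (embed ρ x) v ≡ false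
  lookup-embed x {v} v∉ρ = trans (plug-∉ v∉ρ x _) (lookup-replicate v false)

  lookup-lift : ∀ {k} {ρ : Vec (Fin n) k} c {v} → v ∉ ρ → lookup (lift ρ c) v ≡ ✱
  lookup-lift c {v} v∉ρ = trans (plug-∉ v∉ρ c _) (lookup-replicate v ✱)

  embed-∈ : ∀ {k} {ρ : Vec (Fin n) k} → Unique ρ → ∀ c x → x ∈ᶜ pull ρ c →
    (∀ v → v ∉ ρ → Compat (lookup c v) false) → embed ρ x ∈ᶜ c
  embed-∈ {ρ = ρ} u c x p out v with locate ρ v
  ... | inj₁ (j , refl) = subst₂ Compat (lookup-map j (lookup c) ρ) (sym (plug-∈ u x _ j)) (p j)
  ... | inj₂ v∉ρ        = subst (Compat (lookup c v)) (sym (lookup-embed x v∉ρ)) (out v v∉ρ)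

  embed-∈⁻ : ∀ {k} {ρ : Vec (Fin n) k} → Unique ρ → ∀ c x → embed ρ x ∈ᶜ c →
    x ∈ᶜ pull ρ c × (∀ v → v ∉ ρ → Compat (lookup c v) false)
  embed-∈⁻ {ρ = ρ} u c x p =
    subst (_∈ᶜ pull ρ c) (pull-plug u x _) (pull-∈ ρ c (embed ρ x) p) ,
    λ v v∉ρ → subst (Compat (lookup c v)) (lookup-embed x v∉ρ) (p v)

  lift-∈ : ∀ {k} {ρ : Vec (Fin n) k} → Unique ρ → ∀ c x → x ∈ᶜ lift ρ c ⇔ pull ρ x ∈ᶜ c
  lift-∈ {ρ = ρ} u c x = mk⇔
    (λ p → subst (pull ρ x ∈ᶜ_) (pull-plug u c _) (pull-∈ ρ (lift ρ c) x p))
    from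
    where
    from : pull ρ x ∈ᶜ c → x ∈ᶜ lift ρ c
    from p v with locate ρ v
    ... | inj₁ (j , refl) = subst₂ Compat (sym (plug-∈ u c _ j)) (lookup-map j (lookup x) ρ) (p j)
    ... | inj₂ v∉ρ        = subst (λ s → Compat s (lookup x v)) (sym (lookup-lift c v∉ρ)) tt

  embed-lift : ∀ {k} {ρ : Vec (Fin n) k} → Unique ρ → ∀ c x → x ∈ᶜ c → embed ρ x ∈ᶜ lift ρ c
  embed-lift {ρ = ρ} u c x p = Equivalence.from (lift-∈ u c (embed ρ x)) (subst (_∈ᶜ c) (sym (pull-plug u x _)) p)

  codim-lift : ∀ {k} {ρ : Vec (Fin n) k} → Unique ρ → ∀ c → codim (lift ρ c) ≡ codim c
  codim-lift {ρ = ρ} u c = begin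
    codim (lift ρ c)                                       ≡⟨ codim-split u (lift ρ c) ⟩
    codim (pull ρ (lift ρ c)) + codim (erase ρ (lift ρ c)) ≡⟨ cong₂ _+_ (cong codim (pull-plug u c _)) erased ⟩
    codim c + 0                                            ≡⟨ +-identityʳ _ ⟩
    codim c                                                ∎
    where
    open ≡-Reasoning
    erased : codim (erase ρ (lift ρ c)) ≡ 0
    erased with codim (erase ρ (lift ρ c)) in e
    ... | zero  = refl
    ... | suc _ with codim>0⇒fixed (erase ρ (lift ρ c)) (subst (0 <_) (sym e) z<s)
    ...   | v , fixed with locate ρ v
    ...     | inj₁ (j , refl) = ⊥-elim (fixed (trans (plug-∈ u (replicate _ ✱) _ j) (lookup-replicate j ✱)))
    ...     | inj₂ v∉ρ        = ⊥-elim (fixed (trans (plug-∉ v∉ρ _ _) (lookup-lift c v∉ρ)))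

  -- If the view has full codimension, then `erase ρ c` has codimension 0, so `c` is free off `ρ`.
  lift-pull : ∀ {k} {ρ : Vec (Fin n) k} → Unique ρ → ∀ c →
    codim (pull ρ c) ≡ codim c → c ≡ lift ρ (pull ρ c)
  lift-pull {ρ = ρ} u c h = lookup-ext agree
    where
    erased : codim (erase ρ c) ≡ 0
    erased = +-cancelˡ-≡ (codim (pull ρ c)) _ _
      (trans (sym (codim-split u c)) (trans (sym h) (sym (+-identityʳ _))))
    agree : ∀ v → lookup c v ≡ lookup (lift ρ (pull ρ c)) v
    agree v with locate ρ v
    ... | inj₁ (j , refl) = sym (trans (plug-∈ u (pull ρ c) _ j) (lookup-map j (lookup c) ρ))
    ... | inj₂ v∉ρ        = trans (sym (plug-∉ v∉ρ _ c))
      (trans (codim≡0⇒✱ (erase ρ c) erased v) (sym (lookup-lift (pull ρ c) v∉ρ)))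

  lift-∷ : ∀ {k} v (ρ : Vec (Fin n) k) c → lift (v ∷ ρ) (✱ ∷ c) ≡ lift ρ c
  lift-∷ v ρ c = cong (plug ρ c)
    (trans (cong (replicate n ✱ [ v ]≔_) (sym (lookup-replicate v ✱))) ([]≔-lookup (replicate n ✱) v))

  -- Unseen fixed coordinates of `c` are added one at a time. Each carries 𝟎, since `c` admits false
  -- there, and views of subcubes free off `ρ` merely gain stars.
  introduce : ∀ r {k} {ρ : Vec (Fin n) k} → Unique ρ → ∀ c →
    (∀ v → v ∉ ρ → Compat (lookup c v) false) → r + codim (pull ρ c) ≤ codim c →
    ∃ λ (ρ′ : Vec (Fin n) (r + k)) → Unique ρ′ × pull ρ′ c ≡ replicate r 𝟎 ++ pull ρ c
      × (∀ d → lift ρ′ (replicate r ✱ ++ d) ≡ lift ρ d)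
  introduce r {k} {ρ} u c out h =
    let ρ′ , u′ , pulled , _ , lifts = go r h in ρ′ , u′ , pulled , lifts
    where
    go : ∀ r → r + codim (pull ρ c) ≤ codim c →
      ∃ λ (ρ′ : Vec (Fin n) (r + k)) → Unique ρ′ × pull ρ′ c ≡ replicate r 𝟎 ++ pull ρ c
        × (∀ v → v ∉ ρ′ → Compat (lookup c v) false)
        × (∀ d → lift ρ′ (replicate r ✱ ++ d) ≡ lift ρ d)
    go zero    h = ρ , u , refl , out , λ _ → refl
    go (suc r) h with go r (≤-trans (n≤1+n _) h)
    ... | ρ′ , u′ , pulled , out′ , lifts
      -- One more coordinate is demanded than `ρ′` sees beyond `ρ`, so the erased subcube still has
      -- positive codimension.
      with codim>0⇒fixed (erase ρ′ c) (+-cancelˡ-< (codim (pull ρ′ c)) _ _ (subst₂ _<_ size (codim-split u′ c) h))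
      where
      size : r + codim (pull ρ c) ≡ codim (pull ρ′ c) + 0
      size = trans (sym (codim-𝟎 r (pull ρ c))) (trans (cong codim (sym pulled)) (sym (+-identityʳ _)))
    ...   | v , fixed with locate ρ′ v
    ...     | inj₁ (j , refl) = ⊥-elim (fixed (trans (plug-∈ u′ (replicate _ ✱) _ j) (lookup-replicate j ✱)))
    ...     | inj₂ v∉ρ′ =
      v ∷ ρ′ , v∉ρ′ ∷ u′ ,
      cong₂ _∷_ (fixed-𝟎 (fixed ∘ trans (plug-∉ v∉ρ′ _ c)) (out′ v v∉ρ′)) pulled ,
      (λ { w (_ ∷ w∉ρ′) → out′ w w∉ρ′ }) ,
      λ d → trans (lift-∷ v ρ′ _) (lifts d)

-- Irreducible homogeneous partitions

select : ∀ {m} {P : Fin m → Set} → Decidable P → Subset m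
select P? = tabulate (λ i → does (P? i))

∈-select⁺ : ∀ {m} {P : Fin m → Set} (P? : Decidable P) {i} → P i → i ∈ˢ select P?
∈-select⁺ P? {i} p = lookup⇒[]= i _ (trans (lookup∘tabulate _ i) (dec-true (P? i) p))

∈-select⁻ : ∀ {m} {P : Fin m → Set} (P? : Decidable P) {i} → i ∈ˢ select P? → P i
∈-select⁻ P? {i} h with P? i | trans (sym (lookup∘tabulate (λ i → does (P? i)) i)) ([]=⇒lookup h)
... | yes p | _ = p

module _ {n m : ℕ} (F : Fin m → Subcube n)
  (partition : IsSubcubePartition F) (tight : Tight F) (codim-F : ∀ i → codim (F i) ≡ 4)
  (irreducible : Irreducible F) where

  owner : Point n → Fin m
  owner x = proj₁ (partition x)

  ∈-owner : ∀ x → x ∈ᶜ F (owner x)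
  ∈-owner x = proj₁ (proj₂ (partition x))

  owner-unique : ∀ x {i j} → x ∈ᶜ F i → x ∈ᶜ F j → i ≡ j
  owner-unique x p q = trans (proj₂ (proj₂ (partition x)) _ p) (sym (proj₂ (proj₂ (partition x)) _ q))

  -- Irreducibility for a decidable set of members: two distinct elements give the lower bound on
  -- its size, and a member outside it gives the upper bound.
  no-union : ∀ {P : Fin m → Set} (P? : Decidable P) {i j l} → P i → P j → i ≢ j → ¬ P l →
    ∀ c → ¬ (∀ x → x ∈ᶜ c ⇔ (∃ λ i → P i × x ∈ᶜ F i))
  no-union {P} P? {i} {j} {l} pi pj i≢j ¬pl c union = irreducible (select P?)
    (subst (_< ∣ select P? ∣) (∣⁅x⁆∣≡1 i) (p⊂q⇒∣p∣<∣q∣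
      ( (λ h → subst (_∈ˢ select P?) (sym (x∈⁅y⁆⇒x≡y i h)) (∈-select⁺ P? pi))
      , j , ∈-select⁺ P? pj , λ h → i≢j (sym (x∈⁅y⁆⇒x≡y i h)))))
    (subst (∣ select P? ∣ <_) (∣⊤∣≡n m) (p⊂q⇒∣p∣<∣q∣
      ((λ _ → ∈⊤) , l , ∈⊤ , λ h → ¬pl (∈-select⁻ P? h))))
    (c , λ x → mk⇔
      (λ p → let i , q , r = Equivalence.to (union x) p in i , ∈-select⁺ P? q , r)
      (λ (i , q , r) → Equivalence.from (union x) (i , ∈-select⁻ P? q , r)))

  -- Otherwise the members with 𝟎 at `v` would make up the half cube where `v` is false. That half
  -- contains two members, and the other half contains one more.
  some-✱ : ∀ v → ¬ (∀ i → lookup (F i) v ≢ ✱)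
  some-✱ v fixed = no-union (λ i → is𝟎? (lookup (F i) v)) {owner x₀} {owner x₁} {owner x₂}
    F₀≡𝟎 (owner-𝟎 x₁ x₁v) distinct ¬F₂≡𝟎 (replicate n ✱ [ v ]≔ 𝟎) λ x → mk⇔
      (λ p → owner x
           , owner-𝟎 x (subst (λ s → Compat s (lookup x v)) (lookup∘update v (replicate n ✱) 𝟎) (p v))
           , ∈-owner x)
      (λ (i , e , p) w → half x w (subst (λ s → Compat s (lookup x v)) e (p v)))
    where
    is𝟎? : ∀ s → Dec (s ≡ 𝟎)
    is𝟎? 𝟎 = yes refl
    is𝟎? 𝟏 = no λ ()
    is𝟎? ✱ = no λ ()

    owner-𝟎 : ∀ x → lookup x v ≡ false → lookup (F (owner x)) v ≡ 𝟎
    owner-𝟎 x e = fixed-𝟎 (fixed (owner x)) (subst (Compat _) e (∈-owner x v))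

    half : ∀ x w → lookup x v ≡ false → Compat (lookup (replicate n ✱ [ v ]≔ 𝟎) w) (lookup x w)
    half x w e with w ≟ v
    ... | yes refl rewrite lookup∘update v (replicate n ✱) 𝟎 = e
    ... | no w≢v   rewrite lookup∘update′ w≢v (replicate n ✱) 𝟎 | lookup-replicate w ✱ = tt

    x₀ x₁ x₂ : Point n
    x₀ = replicate n false
    x₂ = replicate n false [ v ]≔ true

    F₀≡𝟎 : lookup (F (owner x₀)) v ≡ 𝟎
    F₀≡𝟎 = owner-𝟎 x₀ (lookup-replicate v false)

    ¬F₂≡𝟎 : lookup (F (owner x₂)) v ≢ 𝟎
    ¬F₂≡𝟎 e = true≢false (subst₂ Compat e (lookup∘update v (replicate n false) true) (∈-owner x₂ v))

    rest>0 : 0 < codim (F (owner x₀) [ v ]≔ ✱)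
    rest>0 = subst (0 <_) (suc-injective (trans (sym (codim-F (owner x₀)))
      (trans (codim-erase (F (owner x₀)) v) (cong (λ s → width s + codim (F (owner x₀) [ v ]≔ ✱)) F₀≡𝟎)))) z<s

    -- `v` is only one of the four coordinates fixed by the owner of `x₀`. Flipping another one,
    -- `w`, leaves this member but stays in the half cube.
    w : Fin n
    w = proj₁ (codim>0⇒fixed (F (owner x₀) [ v ]≔ ✱) rest>0)

    w-fixed : lookup (F (owner x₀) [ v ]≔ ✱) w ≢ ✱
    w-fixed = proj₂ (codim>0⇒fixed (F (owner x₀) [ v ]≔ ✱) rest>0)

    w≢v : w ≢ v
    w≢v e = w-fixed (trans (cong (lookup (F (owner x₀) [ v ]≔ ✱)) e) (lookup∘update v (F (owner x₀)) ✱))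

    x₁ = x₀ [ w ]≔ not (lookup x₀ w)

    x₁v : lookup x₁ v ≡ false
    x₁v = trans (lookup∘update′ (w≢v ∘ sym) x₀ _) (lookup-replicate v false)

    distinct : owner x₀ ≢ owner x₁
    distinct e = w-fixed (trans (lookup∘update′ w≢v (F (owner x₀)) ✱)
      (compat-both _ (lookup x₀ w) (∈-owner x₀ w)
        (subst₂ Compat (cong (λ i → lookup (F i) w) (sym e)) (lookup∘update w x₀ _) (∈-owner x₁ w))))

  -- Equality with the whole of `lift ρ c`, and not only of the views, records that the member fixes
  -- nothing off `ρ`.
  Known : ∀ {k} → Vec (Fin n) k → Subcube k → Set
  Known ρ c = ∃ λ i → F i ≡ lift ρ c

  module _ {k} {ρ : Vec (Fin n) k} (u : Unique ρ) where

    codim-known : ∀ {c} → Known ρ c → codim c ≡ 4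
    codim-known {c} (i , e) = trans (sym (codim-lift u c)) (trans (cong codim (sym e)) (codim-F i))

    codim-pull : ∀ i → codim (pull ρ (F i)) ≤ 4
    codim-pull i = subst (codim (pull ρ (F i)) ≤_) (trans (sym (codim-split u (F i))) (codim-F i)) (m≤m+n _ _)

    known-∈ : ∀ {c} ((i , _) : Known ρ c) x → x ∈ᶜ c → embed ρ x ∈ᶜ F i
    known-∈ {c} (i , e) x p = subst (embed ρ x ∈ᶜ_) (sym e) (embed-lift u c x p)

    -- A common point of the two views, extended by false, would lie in two different members.
    known-disjoint : ∀ {c} ((i , _) : Known ρ c) j → j ≢ i →
      (∀ v → v ∉ ρ → Compat (lookup (F j) v) false) → disjoint (pull ρ (F j)) c ≡ true
    known-disjoint {c} K j j≢i out with disjoint-or-meet (pull ρ (F j)) c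
    ... | inj₁ d           = d
    ... | inj₂ (x , p , q) = ⊥-elim (j≢i (owner-unique (embed ρ x) (embed-∈ u (F j) x p out) (known-∈ K x q)))

    known-outside : ∀ {c} ((i , _) : Known ρ c) → ∀ v → v ∉ ρ → lookup (F i) v ≡ ✱
    known-outside {c} (i , e) v v∉ρ = trans (cong (λ d → lookup d v) e) (lookup-lift c v∉ρ)

    known-pull : ∀ {c} ((i , _) : Known ρ c) → pull ρ (F i) ≡ c
    known-pull {c} (i , e) = trans (cong (pull ρ) e) (pull-plug u c _)

    known-⇔ : ∀ {c} ((i , _) : Known ρ c) x → x ∈ᶜ F i ⇔ pull ρ x ∈ᶜ c
    known-⇔ {c} (i , e) x = subst (λ d → x ∈ᶜ d ⇔ pull ρ x ∈ᶜ c) (sym e) (lift-∈ u c x)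

    known-not-mergeable : ∀ {c d} ((i , _) : Known ρ c) ((j , _) : Known ρ d) → i ≢ j →
      mergeable c d ≡ false
    known-not-mergeable {c} {d} K@(i , _) L@(j , _) i≢j with mergeable c d in m
    ... | false = refl
    ... | true with mergeable⇒union c d m
    ...   | e , codim-e , union
          -- Here `e` has codimension 3, so it misses a point, whose embedding is owned by a third
          -- member.
          with avoidable e (subst (0 <_) (sym (suc-injective (trans codim-e (codim-known K)))) z<s)
    ...     | y , y∉e = ⊥-elim (no-union (λ l → (l ≟ i) ⊎-dec (l ≟ j))
                 (inj₁ refl) (inj₂ refl) i≢j (y∉e ∘ Equivalence.from (union y) ∘ inside) (lift ρ e) λ x → mk⇔
                   (λ p → [ (λ q → i , inj₁ refl , Equivalence.from (known-⇔ K x) q)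
                          , (λ q → j , inj₂ refl , Equivalence.from (known-⇔ L x) q) ]′
                          (Equivalence.to (union (pull ρ x)) (Equivalence.to (lift-∈ u e x) p)))
                   λ { (_ , inj₁ refl , p) → Equivalence.from (lift-∈ u e x)
                         (Equivalence.from (union (pull ρ x)) (inj₁ (Equivalence.to (known-⇔ K x) p)))
                     ; (_ , inj₂ refl , p) → Equivalence.from (lift-∈ u e x)
                         (Equivalence.from (union (pull ρ x)) (inj₂ (Equivalence.to (known-⇔ L x) p))) })
      where
      z = embed ρ y
      pulled : ∀ {f l} ((l′ , _) : Known ρ f) → l ≡ l′ → z ∈ᶜ F l → y ∈ᶜ f
      pulled {f} M refl p = subst (_∈ᶜ f) (pull-plug u y _) (Equivalence.to (known-⇔ M z) p)
      inside : owner z ≡ i ⊎ owner z ≡ j → y ∈ᶜ c ⊎ y ∈ᶜ d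
      inside = Sum.map (λ e → pulled K e (∈-owner z)) (λ e → pulled L e (∈-owner z))

    known-compatible : ∀ {c d} → Known ρ c → Known ρ d → compatible c d ≡ true
    known-compatible {c} {d} K@(i , _) L@(j , _) with i ≟ j
    ... | yes refl rewrite trans (sym (known-pull K)) (known-pull L) | equal-refl d = refl
    ... | no i≢j
      rewrite subst (λ e → disjoint e d ≡ true) (known-pull K)
                (known-disjoint L i i≢j λ v v∉ρ → subst (λ s → Compat s false) (sym (known-outside K v v∉ρ)) tt)
            | known-not-mergeable K L i≢j
      = ∨-zeroʳ _

    -- Restrict all indicators to points that are false off `ρ`. There they sum to 1, and member `i`
    -- has even sum 1 and odd sum 0, so another member has an odd excess; `parity-not-opposite`
    -- makes its view opposite to `c`.
    known-opposite : ∀ {c} → Known ρ c → ∃ λ d → Known ρ d × opposite true c d ≡ true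
    known-opposite {c} K@(i , _) = fromExcess (odd-excess g total c c>0 i self)
      where
      g : Fin m → Point k → ℕ
      g j x = indicator (F j) (embed ρ x)

      total : ∀ x → sum (λ j → g j x) ≡ 1
      total x = sum-1 (owner (embed ρ x))
        (indicator-∈ (F (owner (embed ρ x))) (embed ρ x) (∈-owner (embed ρ x))) λ j j≢o →
        n<1⇒n≡0 (≰⇒> (λ p → j≢o
          (owner-unique (embed ρ x) (indicator>0⇒∈ (F j) (embed ρ x) p) (∈-owner (embed ρ x)))))

      c>0 : 0 < codim c
      c>0 = subst (0 <_) (sym (codim-known K)) z<s

      g-self : g i ≗ indicator c
      g-self x = indicator-cong (F i) c (embed ρ x) x (mk⇔
        (λ p → subst (_∈ᶜ c) (pull-plug u x _) (Equivalence.to (known-⇔ K (embed ρ x)) p)) (known-∈ K x))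

      self : parity true c (g i) < parity false c (g i)
      self rewrite parity-cong true c g-self | parity-cong false c g-self
        | proj₁ (parity-self c) | proj₂ (parity-self c) = z<s

      fromExcess : (∃ λ j → parity false c (g j) < parity true c (g j)) →
        ∃ λ d → Known ρ d × opposite true c d ≡ true
      fromExcess (j , excess) with opposite true c (pull ρ (F j)) in o
      ... | true  = pull ρ (F j)
                  -- Opposite views have equal codimension, here 4, so member `j` fixes nothing off
                  -- `ρ`.
                  , (j , lift-pull u (F j) (trans (sym (opposite⇒codim true c _ o))
                      (trans (codim-known K) (sym (codim-F j)))))
                  , o
      ... | false = ⊥-elim (<⇒≱ excess (subst₂ _≤_
        (sym (parity-cong true c g-pull)) (sym (parity-cong false c g-pull))
        (parity-not-opposite true c (pull ρ (F j)) (subst (_ ≤_) (sym (codim-known K)) (codim-pull j)) o)))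
        where
        -- The odd sum is positive, so some embedded point lies in `F j`; hence `F j` admits false
        -- off `ρ`, and there its indicator is that of its view.
        outside : ∀ v → v ∉ ρ → Compat (lookup (F j) v) false
        outside = let x , p = parity>0⇒∃ true c (≤-<-trans z≤n excess) in
          proj₂ (embed-∈⁻ u (F j) x (indicator>0⇒∈ (F j) (embed ρ x) p))
        g-pull : g j ≗ indicator (pull ρ (F j))
        g-pull x = indicator-cong (F j) (pull ρ (F j)) (embed ρ x) x (mk⇔
          (λ p → proj₁ (embed-∈⁻ u (F j) x p)) (λ p → embed-∈ u (F j) x p outside))

    module _ {cs : List (Subcube k)} (known : All (Known ρ) cs) (covered : ∀ x → Any (x ∈ᶜ_) cs) where

      -- A point of `F i` is covered by a listed member, which must be `F i` as a point has only one
      -- owner.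
      all-known : ∀ i → Any (λ c → F i ≡ lift ρ c) cs
      all-known i = let x , p = inhabited (F i) in find x p known (covered (pull ρ x))
        where
        find : ∀ x → x ∈ᶜ F i → ∀ {cs} → All (Known ρ) cs → Any (pull ρ x ∈ᶜ_) cs →
          Any (λ c → F i ≡ lift ρ c) cs
        find x p (K ∷ _)  (here q)  =
          here (trans (cong F (owner-unique x p (Equivalence.from (known-⇔ K x) q))) (proj₂ K))
        find x p (_ ∷ Ks) (there a) = there (find x p Ks a)

      -- All members are listed, and listed members are ✱ off `ρ`, which tightness forbids at `v`.
      all-located : ∀ v → ∃ λ j → lookup ρ j ≡ v
      all-located v with locate ρ v
      ... | inj₁ p   = p
      ... | inj₂ v∉ρ = let i , fixed = tight v in
        ⊥-elim (fixed (let c , e = Any.satisfied (all-known i) in known-outside (i , e) v v∉ρ))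

      all-coordinates : n ≡ k
      all-coordinates = ≤-antisym
        (injective⇒≤ {f = proj₁ ∘ all-located} λ {v} {w} e →
          trans (sym (proj₂ (all-located v))) (trans (cong (lookup ρ) e) (proj₂ (all-located w))))
        (injective⇒≤ {f = lookup ρ} (lookup-injective u _ _))

      no-pillar : pillar cs ≢ true
      no-pillar h = let j , fixed = pillar-sound cs h in some-✱ (lookup ρ j) λ i e →
        let c-fixed , F≡lift = All.lookupAny fixed (all-known i) in
        true≢false (trans (sym c-fixed) (cong isFixed
          (trans (sym (plug-∈ u _ _ j)) (trans (cong (λ d → lookup d (lookup ρ j)) (sym F≡lift)) e))))

  -- Soundness of the search

  search-sound : ∀ f {k} (cs : List (Subcube k)) {ρ : Vec (Fin n) k} →
    search f cs ≡ true → Unique ρ → All (Known ρ) cs → n ≡ 6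
  extend-sound : ∀ f {k} (cs : List (Subcube k)) t {ρ : Vec (Fin n) k} →
    extend f cs t ≡ true → Unique ρ → All (Known ρ) cs → Known ρ t → n ≡ 6

  search-sound (suc f) {k} cs {ρ} h u known with gap cs in g
  ... | nothing with k ≡ᵇ 6 in e
  ...   | true  = trans (all-coordinates u known (no-gap cs g)) (≡ᵇ⇒≡ k 6 (subst T (sym e) tt))
  ...   | false = ⊥-elim (no-pillar u known (no-gap cs g) h)
  search-sound (suc f) {k} cs {ρ} h u known | just x =
    -- The owner of the gap extended by false is the next member. Its view is among the subcubes
    -- tested by `forCovers`, since no listed member contains the gap.
    let ρ′ , u′ , pulled , lifts = introduce r u (F i) outside (≤-reflexive size) in
    extend-sound f _ _
      (forCovers-sound x cs 4 _ t h (proj₁ (embed-∈⁻ u (F i) x (∈-owner (embed ρ x)))) (codim-pull u i)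
        (All.zipWith (λ (K , x∉c) → known-disjoint u K i (new K x∉c) outside) (known , gap-uncovered cs g)))
      u′
      (map⁺ (All.map (λ (j , e) → j , trans e (sym (lifts _))) known))
      (i , trans (lift-pull u′ (F i) (trans (cong codim pulled) (trans (codim-𝟎 r t) size)))
                 (cong (lift ρ′) pulled))
    where
    i = owner (embed ρ x)
    t = pull ρ (F i)
    r = 4 ∸ codim t
    size : r + codim t ≡ codim (F i)
    size = trans (m∸n+n≡m (codim-pull u i)) (sym (codim-F i))
    outside : ∀ v → v ∉ ρ → Compat (lookup (F i) v) false
    outside = proj₂ (embed-∈⁻ u (F i) x (∈-owner (embed ρ x)))
    new : ∀ {c} ((j , _) : Known ρ c) → ¬ (x ∈ᶜ c) → i ≢ j
    new {c} K x∉c i≡j = x∉c (subst (_∈ᶜ c) (pull-plug u x _)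
      (Equivalence.to (known-⇔ u K (embed ρ x)) (subst (λ l → embed ρ x ∈ᶜ F l) i≡j (∈-owner (embed ρ x)))))

  extend-sound f cs t h u known K
    rewrite all⁺ (compatible t) (All.map (known-compatible u K) known)
    with any (opposite true t) cs
  ... | true  = search-sound f (t ∷ cs) h u (K ∷ known)
  -- No partner is listed, but one exists, so it occurs among the choices tested by `forOpposite`.
  ... | false with known-opposite u K
  ...   | d , L , o with forOpposite-sound true t d _ h o
  ...     | h′ rewrite all⁺ (compatible d) (All.map (known-compatible u L) (K ∷ known)) =
    search-sound f (d ∷ t ∷ cs) h′ u (L ∷ K ∷ known)

-- The case analysis itself, done by evaluation; depth 13 is enough for every branch to close.
search-succeeds : search 13 {0} [] ≡ true
search-succeeds = refl

theorem2p61 : (n m : ℕ) (F : Fin m → Subcube n) →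
    IsHomogeneous n 4 F → Irreducible F → n ≡ 6
theorem2p61 n m F (partition , tight , codim-F) irreducible =
  search-sound F partition tight codim-F irreducible 13 {0} [] {[]} search-succeeds [] []
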